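{- Let $(L,\le,(\sqsubseteq_\alpha)_{\alpha<\kappa})$ be a model of Axioms 1–4, where $\kappa>0$ is an arbitrary ordinal. Let $f:L\to L$ be $\alpha$-monotonic for every ordinal $\alpha<\kappa$. Then $f$ has a least pre-fixed point with respect to $\sqsubseteq$, that is, an element $x$ with $f(x)\sqsubseteq x$ such that $x\sqsubseteq z$ whenever $f(z)\sqsubseteq z$. This element is also the least fixed point of $f$ with respect to $\sqsubseteq$.
   Context: Setting (model of Axioms 1–4). Let $(L,\le)$ be a complete lattice with join operation $\bigvee$ and least element $\perp$. Let $\kappa>0$ be an ordinal, and for each ordinal $\alpha<\kappa$ let $\sqsubseteq_\alpha$ be a preorder on $L$. Derived relations: - $x=_\alpha y$ means $x\sqsubseteq_\alpha y$ and $y\sqsubseteq_\alpha x$. - $x\sqsubset_\alpha y$ means $x\sqsubseteq_\alpha y$ and not $x=_\alpha y$. - $\sqsubset=\bigcup_{\alpha<\kappa}\sqsubset_\alpha$. - $x\sqsubseteq y$ means $x\sqsubset y$ or $x=y$. Derived set, for $x\in L$ and $\alpha<\kappa$: $(x]_\alpha=\{y\in L:\forall\beta<\alpha,\ x=_\beta y\}$. For a set $X$, $X\sqsubseteq_\alpha y$ means $x\sqsubseteq_\alpha y$ for all $x\in X$. The structure is a model of Axioms 1–4 if: - (A1) for all $\alpha<\beta<\kappa$, $x\sqsubseteq_\beta y$ implies $x=_\alpha y$; - (A2) $\bigcap_{\alpha<\kappa}=_\alpha$ is the identity relation on $L$; - (A3) for every $x\in L$, every $\alpha<\kappa$ and every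 $X\subseteq(x]_\alpha$ there is $y\in(x]_\alpha$ with $X\sqsubseteq_\alpha y$ such that for all $z\in(x]_\alpha$ with $X\sqsubseteq_\alpha z$ we have $y\sqsubseteq_\alpha z$ and $y\le z$; - (A4) for every nonempty $X\subseteq L$, every $\alpha<\kappa$ and every $y\in L$, if $y=_\alpha x$ for all $x\in X$ then $y=_\alpha\bigvee X$. A function $f:L\to L$ is $\alpha$-monotonic if $x\sqsubseteq_\alpha y$ implies $f(x)\sqsubseteq_\alpha f(y)$. -}

module Defs where

open import Level using (Level; suc)
open import Data.Product using (_×_; ∃-syntax)
open import Data.Sum using (_⊎_)
open import Function.Bundles using (_⇔_)
open import Induction.WellFounded using (WellFounded)
open import Relation.Binary.Bundles using (Poset)
open import Relation.Binary.Core using (Rel)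
open import Relation.Binary.PropositionalEquality using (_≡_)
open import Relation.Binary.Structures using (IsPreorder; IsStrictTotalOrder)
open import Relation.Nullary using (¬_)
open import Relation.Unary using (Pred; _∈_; _⊆_; Satisfiable)

-- An ordinal κ is given as a well-ordered type, whose elements are the
-- ordinals α < κ.
record Ordinal (ℓ : Level) : Set (suc ℓ) where
  infix 4 _<_
  field
    Below              : Set ℓ
    _<_                : Rel Below ℓ
    isStrictTotalOrder : IsStrictTotalOrder _≡_ _<_
    wellFounded        : WellFounded _<_

-- κ > 0 says exactly that some ordinal lies below κ.
Positive : ∀ {ℓ} → Ordinal ℓ → Set ℓ
Positive κ = Ordinal.Below κ

-- Equality of lattice elements is the equality _≈_ of the poset. Subsets are
-- arbitrary predicates. ⊥ is the join of the empty subset, and the meet of a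
-- subset is the join of its lower bounds.
record CompleteLattice (ℓ : Level) : Set (suc ℓ) where
  field
    poset : Poset ℓ ℓ ℓ
  open Poset poset public using (Carrier; _≈_; _≤_)
  field
    ⋁       : Pred Carrier ℓ → Carrier
    ⋁-upper : ∀ X {x} → x ∈ X → x ≤ ⋁ X
    ⋁-least : ∀ X {z} → (∀ {x} → x ∈ X → x ≤ z) → ⋁ X ≤ z

record StratifiedLattice {ℓ : Level} (κ : Ordinal ℓ) : Set (suc ℓ) where
  open Ordinal κ using (Below; _<_)
  field
    completeLattice : CompleteLattice ℓ
  open CompleteLattice completeLattice public
  infix 4 _⊑[_]_ _=[_]_ _⊏[_]_ _⊏_ _⊑_ _⊑ˢ[_]_
  field
    _⊑[_]_       : Carrier → Below → Carrier → Set ℓ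
    ⊑-isPreorder : ∀ α → IsPreorder _≈_ (_⊑[ α ]_)

  _=[_]_ : Carrier → Below → Carrier → Set ℓ
  x =[ α ] y = x ⊑[ α ] y × y ⊑[ α ] x

  _⊏[_]_ : Carrier → Below → Carrier → Set ℓ
  x ⊏[ α ] y = x ⊑[ α ] y × ¬ (x =[ α ] y)

  _⊏_ : Rel Carrier ℓ
  x ⊏ y = ∃[ α ] x ⊏[ α ] y

  _⊑_ : Rel Carrier ℓ
  x ⊑ y = x ⊏ y ⊎ x ≈ y

  -- The set (x]_α.
  Slice : Carrier → Below → Pred Carrier ℓ
  Slice x α y = ∀ β → β < α → x =[ β ] y

  -- X ⊑_α y for a set X.
  _⊑ˢ[_]_ : Pred Carrier ℓ → Below → Carrier → Set ℓ
  X ⊑ˢ[ α ] y = ∀ x → x ∈ X → x ⊑[ α ] y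

  -- Such an f respects _≈_ whenever axiom₂ below holds, so no separate
  -- congruence condition is imposed on f.
  Monotonic : Below → (Carrier → Carrier) → Set ℓ
  Monotonic α f = ∀ x y → x ⊑[ α ] y → f x ⊑[ α ] f y

  IsLeastPreFixedPoint : (Carrier → Carrier) → Carrier → Set ℓ
  IsLeastPreFixedPoint f x = f x ⊑ x × (∀ z → f z ⊑ z → x ⊑ z)

  IsLeastFixedPoint : (Carrier → Carrier) → Carrier → Set ℓ
  IsLeastFixedPoint f x = f x ≈ x × (∀ z → f z ≈ z → x ⊑ z)

record IsModel {ℓ : Level} {κ : Ordinal ℓ} (L : StratifiedLattice κ) : Set (suc ℓ) where
  open Ordinal κ using (_<_)
  open StratifiedLattice L
  field
    axiom₁ : ∀ α β → α < β → ∀ x y → x ⊑[ β ] y → x =[ α ] y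
    axiom₂ : ∀ x y → (∀ α → x =[ α ] y) ⇔ x ≈ y
    axiom₃ : ∀ x α (X : Pred Carrier ℓ) → X ⊆ Slice x α →
             ∃[ y ] y ∈ Slice x α × X ⊑ˢ[ α ] y ×
               (∀ z → z ∈ Slice x α → X ⊑ˢ[ α ] z → y ⊑[ α ] z × y ≤ z)
    axiom₄ : ∀ (X : Pred Carrier ℓ) → Satisfiable X → ∀ α y →
             (∀ x → x ∈ X → y =[ α ] x) → y =[ α ] ⋁ X

{-# OPTIONS --safe #-}

-- Call y an α-solution if f y =_α y and y is ⊑_α-least among the α-pre-fixed
-- points of f in (y]_α. Elements that are γ-solutions for all γ ≤ β agree
-- modulo =_β, so solutions up to the ordinals β < α form a coherent family,
-- which glues to a single element x. The Knaster–Tarski argument inside (x]_α,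
-- for the preorder ⊑_α, then yields a solution up to α. Gluing over all α < κ
-- gives a fixed point x. If f z ⊑ z and z is not x, let α be least with x ≠_α z:
-- then z lies in (x]_α and f z ⊑_α z, hence x ⊏_α z.

module Submission where

open import Defs
open import Level using (Level)
open import Axiom.ExcludedMiddle using (ExcludedMiddle)
open import Data.Empty using (⊥-elim)
open import Data.Product using (_×_; _,_; proj₁; proj₂; ∃-syntax; swap)
open import Data.Sum using (_⊎_; inj₁; inj₂)
open import Data.Unit.Polymorphic using (⊤; tt)
open import Function.Bundles using (Equivalence)
open import Induction.WellFounded using (Acc; acc)
open import Relation.Binary.Bundles using (Poset)
open import Relation.Binary.Definitions using (tri<; tri≈; tri>)
open import Relation.Binary.PropositionalEquality using (_≡_; refl)
open import Relation.Binary.Structures using (IsPreorder; IsStrictTotalOrder)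
open import Relation.Nullary using (¬_; yes; no)
open import Relation.Unary using (Pred; _∈_)

module Minimal {ℓ : Level} (em : ExcludedMiddle ℓ) (κ : Ordinal ℓ) where
  open Ordinal κ

  least : (P : Pred Below ℓ) → ∀ {α} → Acc _<_ α → ¬ P α →
          ∃[ β ] ¬ P β × (∀ γ → γ < β → P γ)
  least P {α} (acc rs) ¬Pα with em {∃[ γ ] (γ < α × ¬ P γ)}
  ... | yes (γ , γ<α , ¬Pγ) = least P (rs γ<α) ¬Pγ
  ... | no minimal          = α , ¬Pα , below
    where
    below : ∀ γ → γ < α → P γ
    below γ γ<α with em {P γ}
    ... | yes Pγ = Pγ
    ... | no ¬Pγ = ⊥-elim (minimal (γ , γ<α , ¬Pγ))

  -- Excluded middle enters through this module alone. Later `P α` is `x =[ α ] z`, and the second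
  -- alternative gives the first level at which `x` and `z` differ.
  all-or-least-failure : (P : Pred Below ℓ) →
    (∀ α → P α) ⊎ ∃[ β ] ¬ P β × (∀ γ → γ < β → P γ)
  all-or-least-failure P with em {∃[ α ] ¬ P α}
  ... | yes (α , ¬Pα) = inj₂ (least P (wellFounded α) ¬Pα)
  ... | no none       = inj₁ holds
    where
    holds : ∀ α → P α
    holds α with em {P α}
    ... | yes Pα = Pα
    ... | no ¬Pα = ⊥-elim (none (α , ¬Pα))

module Model {ℓ : Level} {κ : Ordinal ℓ} {L : StratifiedLattice κ} (M : IsModel L) where
  open Ordinal κ
  open IsStrictTotalOrder isStrictTotalOrder using (compare) renaming (trans to <-trans)
  open StratifiedLattice L
  open IsModel M
  open Poset poset public using (antisym) renaming (trans to ≤-trans)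
  open import Relation.Binary.Construct.StrictToNonStrict _≡_ _<_ public
    using () renaming (_≤_ to _≼_)

  <-≼-trans : ∀ {α β γ} → α < β → β ≼ γ → α < γ
  <-≼-trans α<β (inj₁ β<γ)  = <-trans α<β β<γ
  <-≼-trans α<β (inj₂ refl) = α<β

  ≼-<-trans : ∀ {α β γ} → α ≼ β → β < γ → α < γ
  ≼-<-trans (inj₁ α<β)  β<γ = <-trans α<β β<γ
  ≼-<-trans (inj₂ refl) β<γ = β<γ

  ⊑-refl : ∀ {α x} → x ⊑[ α ] x
  ⊑-refl {α} = IsPreorder.refl (⊑-isPreorder α)

  ⊑-trans : ∀ {α x y z} → x ⊑[ α ] y → y ⊑[ α ] z → x ⊑[ α ] z
  ⊑-trans {α} = IsPreorder.trans (⊑-isPreorder α)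

  =-refl : ∀ {α x} → x =[ α ] x
  =-refl = ⊑-refl , ⊑-refl

  =-trans : ∀ {α x y z} → x =[ α ] y → y =[ α ] z → x =[ α ] z
  =-trans (p , p′) (q , q′) = ⊑-trans p q , ⊑-trans q′ p′

  ≈⇒= : ∀ {α x y} → x ≈ y → x =[ α ] y
  ≈⇒= {α} {x} {y} x≈y = Equivalence.from (axiom₂ x y) x≈y α

  =⇒≈ : ∀ {x y} → (∀ α → x =[ α ] y) → x ≈ y
  =⇒≈ {x} {y} = Equivalence.to (axiom₂ x y)

  =-weaken : ∀ {α β x y} → α ≼ β → x =[ β ] y → x =[ α ] y
  =-weaken {α} {β} (inj₁ α<β) (p , _) = axiom₁ α β α<β _ _ p
  =-weaken         (inj₂ refl) p      = p

  Slice-refl : ∀ {α x} → x ∈ Slice x α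
  Slice-refl _ _ = =-refl

  =-Slice : ∀ {α x y} → x =[ α ] y → y ∈ Slice x α
  =-Slice p β β<α = =-weaken (inj₁ β<α) p

  Slice-trans : ∀ {α x y z} → y ∈ Slice x α → z ∈ Slice y α → z ∈ Slice x α
  Slice-trans p q β β<α = =-trans (p β β<α) (q β β<α)

  Slice-sym : ∀ {α x y} → y ∈ Slice x α → x ∈ Slice y α
  Slice-sym p β β<α = swap (p β β<α)

  -- Apply `axiom₃` to the whole class of `x`: each of its members bounds it for `⊑[ α ]`, so the
  -- least bound stays in the class and is `≤` every member.
  =-class-minimum : ∀ α x → ∃[ y ] y =[ α ] x × (∀ z → x =[ α ] z → y ≤ z)
  =-class-minimum α x
    with y , _ , X⊑y , y-least ← axiom₃ x α (λ w → w =[ α ] x) (λ w=x → =-Slice (swap w=x))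
    = y , (proj₁ (y-least x Slice-refl (λ _ → proj₁)) , X⊑y x =-refl)
    , λ z x=z → proj₂ (y-least z (=-Slice x=z) (λ w w=x → ⊑-trans (proj₁ w=x) (proj₁ x=z)))

  module Glue (D : Pred Below ℓ) (y : ∀ β → β ∈ D → Carrier)
    (coherent : ∀ {β γ} (d : β ∈ D) (e : γ ∈ D) → β ≼ γ → y β d =[ β ] y γ e) where

    -- The ≤-least representative of the =_β-class of y β d. These
    -- representatives increase with β, so discarding an initial part of the
    -- family does not change its join and axiom₄ applies to the rest.
    rep : ∀ β → β ∈ D → Carrier
    rep β d = proj₁ (=-class-minimum β (y β d))

    rep-= : ∀ {β} (d : β ∈ D) → rep β d =[ β ] y β d
    rep-= {β} d = proj₁ (proj₂ (=-class-minimum β (y β d)))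

    y=rep : ∀ {β γ} (d : β ∈ D) (e : γ ∈ D) → β ≼ γ → y β d =[ β ] rep γ e
    y=rep d e β≼γ = =-trans (coherent d e β≼γ) (=-weaken β≼γ (swap (rep-= e)))

    rep-mono : ∀ {β γ} (d : β ∈ D) (e : γ ∈ D) → β ≼ γ → rep β d ≤ rep γ e
    rep-mono {β} {γ} d e β≼γ = proj₂ (proj₂ (=-class-minimum β (y β d))) (rep γ e) (y=rep d e β≼γ)

    Reps : Pred Carrier ℓ
    Reps w = ∃[ γ ] ∃[ e ] w ≡ rep γ e

    RepsFrom : Below → Pred Carrier ℓ
    RepsFrom β w = ∃[ γ ] ∃[ e ] β ≼ γ × w ≡ rep γ e

    glue : Carrier
    glue = ⋁ Reps

    ⋁RepsFrom≈glue : ∀ {β} → β ∈ D → ⋁ (RepsFrom β) ≈ glue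
    ⋁RepsFrom≈glue {β} d = antisym
      (⋁-least (RepsFrom β) λ { (γ , e , _ , w≡) → ⋁-upper Reps (γ , e , w≡) })
      (⋁-least Reps λ { (γ , e , refl) → bound γ e })
      where
      bound : ∀ γ (e : γ ∈ D) → rep γ e ≤ ⋁ (RepsFrom β)
      bound γ e with compare β γ
      ... | tri< β<γ _ _ = ⋁-upper (RepsFrom β) (γ , e , inj₁ β<γ , refl)
      ... | tri≈ _ β≡γ _ = ⋁-upper (RepsFrom β) (γ , e , inj₂ β≡γ , refl)
      ... | tri> _ _ γ<β = ≤-trans (rep-mono e d (inj₁ γ<β))
                             (⋁-upper (RepsFrom β) (β , d , inj₂ refl , refl))

    glue-= : ∀ {β} (d : β ∈ D) → y β d =[ β ] glue
    glue-= {β} d = =-trans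
      -- `axiom₄` demands a nonempty set; the tail starts at `β` itself, so `rep β d` is a member.
      (axiom₄ (RepsFrom β) (rep β d , β , d , inj₂ refl , refl) β (y β d)
        λ { _ (γ , e , β≼γ , refl) → y=rep d e β≼γ })
      (≈⇒= (⋁RepsFrom≈glue d))

  module FixedPoint (f : Carrier → Carrier) (f-mono : ∀ α → Monotonic α f) where

    f-cong : ∀ {α x y} → x =[ α ] y → f x =[ α ] f y
    f-cong {α} (p , q) = f-mono α _ _ p , f-mono α _ _ q

    Solves : Below → Pred Carrier ℓ
    Solves α y = f y =[ α ] y × (∀ z → z ∈ Slice y α → f z ⊑[ α ] z → y ⊑[ α ] z)

    SolvesUpTo : Below → Pred Carrier ℓ
    SolvesUpTo α y = ∀ γ → γ ≼ α → Solves γ y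

    Solves-resp-= : ∀ {α x y} → x =[ α ] y → Solves α x → Solves α y
    Solves-resp-= x=y (fx=x , x-least) =
      =-trans (f-cong (swap x=y)) (=-trans fx=x x=y) ,
      λ z z∈ fz⊑z → ⊑-trans (proj₂ x=y) (x-least z (Slice-trans (=-Slice x=y) z∈) fz⊑z)

    Solves-unique : ∀ {α x y} → y ∈ Slice x α → Solves α x → Solves α y → x =[ α ] y
    Solves-unique y∈ (fx=x , x-least) (fy=y , y-least) =
      x-least _ y∈ (proj₁ fy=y) , y-least _ (Slice-sym y∈) (proj₁ fx=x)

    -- By induction `x` and `y` agree at every level below `α`, so they share a slice, and each is a
    -- least `α`-pre-fixed point there. Placing them in one slice is what the solutions at lower
    -- levels are for.
    agree : ∀ {α β x y} → Acc _<_ α → α ≼ β → SolvesUpTo α x → SolvesUpTo β y → x =[ α ] y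
    agree {α} (acc rs) α≼β sx sy = Solves-unique
      (λ γ γ<α → agree (rs γ<α) (inj₁ (<-≼-trans γ<α α≼β))
        (λ δ δ≼γ → sx δ (inj₁ (≼-<-trans δ≼γ γ<α))) sy)
      (sx α (inj₂ refl)) (sy α α≼β)

    glue-solutions : (D : Pred Below ℓ) → (∀ β → β ∈ D → ∃[ y ] SolvesUpTo β y) →
                     ∃[ x ] (∀ β → β ∈ D → Solves β x)
    glue-solutions D sol = glue , λ β d →
      Solves-resp-= (glue-= d) (proj₂ (sol β d) β (inj₂ refl))
      where
      open Glue D (λ β d → proj₁ (sol β d))
        (λ d e β≼γ → agree (wellFounded _) β≼γ (proj₂ (sol _ d)) (proj₂ (sol _ e)))

    -- The sup of the ⊑_α-lower bounds of the α-pre-fixed points is their inf.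
    knaster-tarski : ∀ α x → (∀ β → β < α → f x =[ β ] x) →
                     ∃[ m ] m ∈ Slice x α × Solves α m
    knaster-tarski α x fx=x
      with m , m∈ , X⊑m , m-least ← axiom₃ x α
             (λ w → w ∈ Slice x α × (∀ z → z ∈ Slice x α → f z ⊑[ α ] z → w ⊑[ α ] z)) proj₁
      = m , m∈ , (fm⊑m , m⊑ (f m) (f-Slice m∈) (f-mono α _ _ fm⊑m))
      , λ z z∈ → m⊑ z (Slice-trans m∈ z∈)
      where
      -- Since `f` fixes `x` at all levels below `α`, it restricts to a map of the slice into
      -- itself.
      f-Slice : ∀ {z} → z ∈ Slice x α → f z ∈ Slice x α
      f-Slice z∈ β β<α = =-trans (swap (fx=x β β<α)) (f-cong (z∈ β β<α))

      m⊑ : ∀ z → z ∈ Slice x α → f z ⊑[ α ] z → m ⊑[ α ] z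
      m⊑ z z∈ fz⊑z = proj₁ (m-least z z∈ λ w w∈X → proj₂ w∈X z z∈ fz⊑z)

      fm⊑m : f m ⊑[ α ] m
      -- From `m ⊑[ α ] z` follows `f m ⊑[ α ] f z ⊑[ α ] z`, so `f m` is one of the lower bounds
      -- whose supremum is `m`.
      fm⊑m = X⊑m (f m) (f-Slice m∈ , λ z z∈ fz⊑z →
        ⊑-trans (f-mono α _ _ (m⊑ z z∈ fz⊑z)) fz⊑z)

    solution-up-to : ∀ {α} → Acc _<_ α → ∃[ y ] SolvesUpTo α y
    solution-up-to {α} (acc rs)
      -- Zero, successor and limit `α` are treated alike; for the least `α` the family is empty and
      -- `x` is the bottom element.
      with x , x-solves ← glue-solutions (_< α) (λ β β<α → solution-up-to (rs β<α))
      with m , m∈ , m-solves ← knaster-tarski α x (λ β β<α → proj₁ (x-solves β β<α))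
      -- Replacing `x` by `m` keeps the lower levels solved, because `m` stays in the slice of `x`.
      = m , λ { γ (inj₁ γ<α)  → Solves-resp-= (m∈ γ γ<α) (x-solves γ γ<α)
              ; γ (inj₂ refl) → m-solves }

    solution : ∃[ x ] (∀ α → Solves α x)
    solution with x , x-solves ← glue-solutions (λ _ → ⊤) (λ β _ → solution-up-to (wellFounded β))
      = x , λ α → x-solves α tt

    solution-fixed : ∀ {x} → (∀ α → Solves α x) → f x ≈ x
    solution-fixed x-solves = =⇒≈ λ α → proj₁ (x-solves α)

    -- A strict inequality at level `γ` cannot occur below `α`, where `f z` and `z` agree; if `γ`
    -- lies above `α`, `axiom₁` makes them agree at `α` too.
    prefixed-at : ∀ {α z} → (∀ β → β < α → f z =[ β ] z) → f z ⊑ z → f z ⊑[ α ] z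
    prefixed-at {α} fz=z (inj₂ fz≈z) = proj₁ (≈⇒= fz≈z)
    prefixed-at {α} fz=z (inj₁ (γ , fz⊑z , fz≠z)) with compare α γ
    ... | tri< α<γ _ _  = proj₁ (axiom₁ α γ α<γ _ _ fz⊑z)
    ... | tri≈ _ refl _ = fz⊑z
    ... | tri> _ _ γ<α  = ⊥-elim (fz≠z (fz=z γ γ<α))

    module _ (em : ExcludedMiddle ℓ) where
      open Minimal em κ

      solution-least : ∀ {x} → (∀ α → Solves α x) → ∀ z → f z ⊑ z → x ⊑ z
      solution-least {x} x-solves z fz⊑z with all-or-least-failure (λ α → x =[ α ] z)
      ... | inj₁ x=z            = inj₂ (=⇒≈ x=z)
      ... | inj₂ (α , x≠z , z∈) = inj₁ (α , proj₂ (x-solves α) z z∈ fz⊑αz , x≠z)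
        where
        fz⊑αz : f z ⊑[ α ] z
        fz⊑αz = prefixed-at
          -- Below `α`, `z` inherits being fixed from `x`, along the chain `f z`, `f x`, `x`, `z`.
          (λ β β<α → =-trans (f-cong (swap (z∈ β β<α)))
            (=-trans (proj₁ (x-solves β)) (z∈ β β<α)))
          fz⊑z

mainTheorem2 : ∀ {ℓ : Level} → ExcludedMiddle ℓ →
    (κ : Ordinal ℓ) → Positive κ →
    (L : StratifiedLattice κ) → IsModel L →
    let open StratifiedLattice L in
    (f : Carrier → Carrier) → (∀ α → Monotonic α f) →
    ∃[ x ] IsLeastPreFixedPoint f x × IsLeastFixedPoint f x
mainTheorem2 em κ _ L M f f-mono =
  x , (inj₂ fx≈x , x-least) , (fx≈x , λ z fz≈z → x-least z (inj₂ fz≈z))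
  where
  open StratifiedLattice L using (_≈_; _⊑_)
  open Model M
  open FixedPoint f f-mono

  x = proj₁ solution

  fx≈x : f x ≈ x
  fx≈x = solution-fixed (proj₂ solution)

  x-least : ∀ z → f z ⊑ z → x ⊑ z
  x-least = solution-least em (proj₂ solution)
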